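{- Let $G$ be a finite complete group, let $g\in G$ be an involution, and let $G_2$ be the set of all involutions of $G$. Then $G$ is a restricted GCI-group if and only if both of the following hold: (i) $G_2=C(g)$, where $C(g)$ is the conjugacy class of $g$ in $G$; and (ii) for any generalized Cayley subsets $S_1$ and $S_2$ of $G$ induced by $\sigma(g)$, $GC(G,S_1,\sigma(g))\cong GC(G,S_2,\sigma(g))$ implies that there exists $\sigma(x)\in\mathrm{Aut}(G)$ (with $x\in G$) such that $gS_2=(gS_1)^{\sigma(x)}$.
   Context: A group $G$ is complete if $Z(G)=\{e\}$ and $\mathrm{Aut}(G)=\mathrm{Inn}(G)$. An involution is an element of order $2$. For $y\in G$ and $\alpha\in\mathrm{Aut}(G)$, $y^\alpha$ denotes the image of $y$ under $\alpha$; for $S\subseteq G$, $S^\alpha=\{s^\alpha\mid s\in S\}$ and $gS=\{gs\mid s\in S\}$. Products of automorphisms act by $y^{\beta\alpha}=(y^\alpha)^\beta$. For $x\in G$, $\sigma(x)$ is the inner automorphism $h\mapsto xhx^{ -1}$. Generalized Cayley graphs: given a finite group $G$, an automorphism $\alpha\in\mathrm{Aut}(G)$ and $S\subseteq G$, suppose (a) $\alpha^2=\mathrm{id}$; (b) for every $y\in G$, $(y^{ -1})^\alpha y\notin S$; (c) for all $y,h\in G$, if $(h^{ -1})^\alpha y\in S$ then $(y^{ -1})^\alpha h\in S$. Then $S$ is called a generalized Cayley subset of $G$ induced by $\alpha$, and $GC(G,S,\alpha)$ is the graph with vertex set $G$ and edge set $\{\{y,h\}\mid (y^{ -1})^\alpha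 h\in S\}$. A finite group $G$ is a restricted GCI-group if for any two generalized Cayley graphs $X_i=GC(G,S_i,\alpha_i)$ $(i=1,2)$ of $G$ with both $\alpha_1$ and $\alpha_2$ of order $2$ in $\mathrm{Aut}(G)$, $X_1\cong X_2$ implies that there exist $y\in G$ and $\gamma\in\mathrm{Aut}(G)$ such that $\alpha_2=\gamma\alpha_1\gamma^{ -1}$ and $S_2=y^{\alpha_2}S_1^\gamma y^{ -1}$. -}

module Defs where

open import Algebra.Bundles using (Group)
import Algebra.Morphism.Construct.Composition as Composition
import Algebra.Morphism.Construct.Identity as Identity
open import Algebra.Morphism.Structures using (module GroupMorphisms)
import Algebra.Properties.Group as GroupProperties
open import Data.Fin using (Fin)
open import Data.Product using (∃; _×_; _,_; proj₁; proj₂)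
open import Function.Bundles using (Inverse; _⇔_)
open import Level using (Level; _⊔_; suc)
open import Relation.Binary.Bundles using (Setoid)
open import Relation.Binary.Core using (Rel)
open import Relation.Binary.Definitions using (Symmetric; _Respects_; _Respects₂_)
import Relation.Binary.PropositionalEquality.Properties as ≡
import Relation.Binary.Reasoning.Setoid as SetoidReasoning
open import Relation.Nullary using (¬_)
open import Relation.Unary using (Pred; Decidable; _≐_)

private
  variable
    a b c e f ℓ ℓ₁ ℓ₂ : Level

------------------------------------------------------------------------
-- Simple graphs

record Graph (c ℓ e : Level) : Set (suc (c ⊔ ℓ ⊔ e)) where
  field
    vertices : Setoid c ℓ

  open Setoid vertices using (_≈_) renaming (Carrier to Vertex) public

  field
    Adjacent    : Rel Vertex e
    adj-resp    : Adjacent Respects₂ _≈_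
    adj-sym     : Symmetric Adjacent
    adj-irrefl  : ∀ x → ¬ Adjacent x x

infix 4 _≅_

record _≅_ (X : Graph a ℓ₁ e) (Y : Graph b ℓ₂ f) : Set (a ⊔ b ⊔ ℓ₁ ⊔ ℓ₂ ⊔ e ⊔ f) where
  private
    module X = Graph X
    module Y = Graph Y

  field
    bijection : Inverse X.vertices Y.vertices

  open Inverse bijection using (to)

  field
    preserves : ∀ x y → X.Adjacent x y ⇔ Y.Adjacent (to x) (to y)

------------------------------------------------------------------------
-- Groups

IsFinite : Group c ℓ → Set (c ⊔ ℓ)
IsFinite G = ∃ λ n → Inverse (Group.setoid G) (≡.setoid (Fin n))

module _ (G : Group c ℓ) where
  open Group G

  Involution : Pred Carrier ℓ
  Involution x = ¬ (x ≈ ε) × x ∙ x ≈ ε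

  Center : Pred Carrier (c ⊔ ℓ)
  Center z = ∀ x → z ∙ x ≈ x ∙ z

  ConjugacyClass : Carrier → Pred Carrier (c ⊔ ℓ)
  ConjugacyClass g h = ∃ λ x → h ≈ x ∙ g ∙ x ⁻¹

------------------------------------------------------------------------
-- The automorphism group

module _ (G : Group c ℓ) where
  open Group G
  open GroupMorphisms rawGroup rawGroup using (IsGroupIsomorphism)

  record Automorphism : Set (c ⊔ ℓ) where
    field
      ⟦_⟧                : Carrier → Carrier
      isGroupIsomorphism : IsGroupIsomorphism ⟦_⟧

    open IsGroupIsomorphism isGroupIsomorphism public

open Automorphism public using (⟦_⟧)

module _ {G : Group c ℓ} where
  open Group G
  open GroupMorphisms rawGroup rawGroup using (IsGroupIsomorphism)
  open GroupProperties G
  open SetoidReasoning setoid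

  private
    homo⇒iso : (φ : Carrier → Carrier) →
               (∀ {x y} → x ≈ y → φ x ≈ φ y) →
               (∀ x y → φ (x ∙ y) ≈ φ x ∙ φ y) →
               (∀ {x y} → φ x ≈ φ y → x ≈ y) →
               (∀ y → ∃ λ x → φ x ≈ y) →
               IsGroupIsomorphism φ
    homo⇒iso φ φ-cong φ-homo φ-inj φ-surj = record
      { isGroupMonomorphism = record
        { isGroupHomomorphism = record
          { isMonoidHomomorphism = record
            { isMagmaHomomorphism = record
              { isRelHomomorphism = record { cong = φ-cong }
              ; homo              = φ-homo
              }
            ; ε-homo = φε≈ε
            }
          ; ⁻¹-homo = λ x → inverseˡ-unique (φ (x ⁻¹)) (φ x)
              (trans (sym (φ-homo (x ⁻¹) x)) (trans (φ-cong (inverseˡ x)) φε≈ε))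
          }
        ; injective = φ-inj
        }
      ; surjective = λ y → proj₁ (φ-surj y) ,
          λ z≈x → trans (φ-cong z≈x) (proj₂ (φ-surj y))
      }
      where
      φε≈ε : φ ε ≈ ε
      φε≈ε = ∙-cancelˡ (φ ε) (φ ε) ε
        (trans (sym (φ-homo ε ε)) (trans (φ-cong (identityˡ ε)) (sym (identityʳ (φ ε)))))

  idAut : Automorphism G
  idAut = record { isGroupIsomorphism = Identity.isGroupIsomorphism rawGroup refl }

  infixr 9 _∘Aut_

  _∘Aut_ : Automorphism G → Automorphism G → Automorphism G
  β ∘Aut α = record
    { isGroupIsomorphism = Composition.isGroupIsomorphism trans
        (Automorphism.isGroupIsomorphism α) (Automorphism.isGroupIsomorphism β)
    }

  module _ (α : Automorphism G) where
    open Automorphism α using (⟦⟧-cong; ∙-homo; injective; surjective)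

    private
      inv : Carrier → Carrier
      inv y = proj₁ (surjective y)

      α-inv : ∀ y → ⟦ α ⟧ (inv y) ≈ y
      α-inv y = proj₂ (surjective y) refl

    invAut : Automorphism G
    invAut = record
      { ⟦_⟧                = inv
      ; isGroupIsomorphism = homo⇒iso inv
          (λ {x} {y} x≈y → injective (trans (α-inv x) (trans x≈y (sym (α-inv y)))))
          (λ x y → injective (trans (α-inv (x ∙ y))
            (trans (∙-cong (sym (α-inv x)) (sym (α-inv y))) (sym (∙-homo (inv x) (inv y))))))
          (λ {x} {y} eq → trans (sym (α-inv x)) (trans (⟦⟧-cong eq) (α-inv y)))
          (λ y → ⟦ α ⟧ y , injective (α-inv (⟦ α ⟧ y)))
      }

    invAut-inverseʳ : ∀ y → ⟦ α ⟧ (⟦ invAut ⟧ y) ≈ y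
    invAut-inverseʳ = α-inv

    invAut-inverseˡ : ∀ y → ⟦ invAut ⟧ (⟦ α ⟧ y) ≈ y
    invAut-inverseˡ y = injective (α-inv (⟦ α ⟧ y))

  σ : Carrier → Automorphism G
  σ x = record
    { ⟦_⟧                = conj
    ; isGroupIsomorphism = homo⇒iso conj
        (λ eq → ∙-congʳ (∙-congˡ eq))
        conj-homo
        (λ {y} {z} eq → ∙-cancelˡ x y z (∙-cancelʳ (x ⁻¹) (x ∙ y) (x ∙ z) eq))
        (λ y → x ⁻¹ ∙ y ∙ x , conj-surj y)
    }
    where
    conj : Carrier → Carrier
    conj h = x ∙ h ∙ x ⁻¹

    conj-homo : ∀ y z → conj (y ∙ z) ≈ conj y ∙ conj z
    conj-homo y z = begin
      x ∙ (y ∙ z) ∙ x ⁻¹                ≈⟨ ∙-congʳ (assoc x y z) ⟨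
      x ∙ y ∙ z ∙ x ⁻¹                  ≈⟨ assoc (x ∙ y) z (x ⁻¹) ⟩
      x ∙ y ∙ (z ∙ x ⁻¹)                ≈⟨ ∙-congˡ (\\-leftDividesʳ x (z ∙ x ⁻¹)) ⟨
      x ∙ y ∙ (x ⁻¹ ∙ (x ∙ (z ∙ x ⁻¹))) ≈⟨ assoc (x ∙ y) (x ⁻¹) _ ⟨
      x ∙ y ∙ x ⁻¹ ∙ (x ∙ (z ∙ x ⁻¹))   ≈⟨ ∙-congˡ (assoc x z (x ⁻¹)) ⟨
      x ∙ y ∙ x ⁻¹ ∙ (x ∙ z ∙ x ⁻¹)     ∎

    conj-surj : ∀ y → conj (x ⁻¹ ∙ y ∙ x) ≈ y
    conj-surj y = begin
      x ∙ (x ⁻¹ ∙ y ∙ x) ∙ x ⁻¹   ≈⟨ ∙-congʳ (∙-congˡ (assoc (x ⁻¹) y x)) ⟩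
      x ∙ (x ⁻¹ ∙ (y ∙ x)) ∙ x ⁻¹ ≈⟨ ∙-congʳ (\\-leftDividesˡ x (y ∙ x)) ⟩
      y ∙ x ∙ x ⁻¹                ≈⟨ //-rightDividesʳ x y ⟩
      y                           ∎

-- Multiplication is composition of functions, right factor applied first.
Aut : Group c ℓ → Group (c ⊔ ℓ) (c ⊔ ℓ)
Aut G = record
  { Carrier = Automorphism G
  ; _≈_     = λ α β → ∀ y → ⟦ α ⟧ y ≈ ⟦ β ⟧ y
  ; _∙_     = _∘Aut_
  ; ε       = idAut
  ; _⁻¹     = invAut
  ; isGroup = record
    { isMonoid = record
      { isSemigroup = record
        { isMagma = record
          { isEquivalence = record
            { refl  = λ _ → refl
            ; sym   = λ eq y → sym (eq y)
            ; trans = λ eq₁ eq₂ y → trans (eq₁ y) (eq₂ y)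
            }
          ; ∙-cong = λ {α} {β} {γ} {δ} α≈β γ≈δ y →
              trans (Automorphism.⟦⟧-cong α (γ≈δ y)) (α≈β (⟦ δ ⟧ y))
          }
        ; assoc = λ _ _ _ _ → refl
        }
      ; identity = (λ _ _ → refl) , (λ _ _ → refl)
      }
    ; inverse = invAut-inverseˡ , invAut-inverseʳ
    ; ⁻¹-cong = λ {α} {β} α≈β y → Automorphism.injective α
        (trans (invAut-inverseʳ α y)
          (trans (sym (invAut-inverseʳ β y)) (sym (α≈β (⟦ invAut β ⟧ y)))))
    }
  }
  where open Group G

Inner : (G : Group c ℓ) → Pred (Automorphism G) (c ⊔ ℓ)
Inner G α = ∃ λ x → Group._≈_ (Aut G) α (σ x)

record IsComplete (G : Group c ℓ) : Set (c ⊔ ℓ) where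
  open Group G
  field
    center-trivial : Center G ≐ (_≈ ε)
    all-inner      : ∀ α → Inner G α

------------------------------------------------------------------------
-- Subsets

-- Membership is decidable and invariant under the setoid equality, so that a
-- finite group has exactly its usual finite collection of subsets up to _≐_.
record Subset (G : Group c ℓ) : Set (suc (c ⊔ ℓ)) where
  open Group G
  field
    Member  : Pred Carrier (c ⊔ ℓ)
    resp    : Member Respects _≈_
    member? : Decidable Member

open Subset public using (Member)

module _ (G : Group c ℓ) where
  open Group G

  -- g S
  leftMul : ∀ {p} → Carrier → Pred Carrier p → Pred Carrier (c ⊔ ℓ ⊔ p)
  leftMul g S h = ∃ λ s → S s × h ≈ g ∙ s

  -- S g
  rightMul : ∀ {p} → Pred Carrier p → Carrier → Pred Carrier (c ⊔ ℓ ⊔ p)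
  rightMul S g h = ∃ λ s → S s × h ≈ s ∙ g

  -- S^α
  image : ∀ {p} → Automorphism G → Pred Carrier p → Pred Carrier (c ⊔ ℓ ⊔ p)
  image α S h = ∃ λ s → S s × h ≈ ⟦ α ⟧ s

------------------------------------------------------------------------
-- Generalized Cayley graphs

record IsGenCayleySubset {G : Group c ℓ} (α : Automorphism G) (S : Subset G)
                         : Set (c ⊔ ℓ) where
  open Group G
  private module A = Group (Aut G)
  field
    squares-to-id : α A.∙ α A.≈ A.ε
    no-loops      : ∀ y → ¬ Member S (⟦ α ⟧ (y ⁻¹) ∙ y)
    symmetric     : ∀ y h → Member S (⟦ α ⟧ (h ⁻¹) ∙ y) → Member S (⟦ α ⟧ (y ⁻¹) ∙ h)

GC : (G : Group c ℓ) (S : Subset G) (α : Automorphism G) →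
     IsGenCayleySubset α S → Graph c ℓ (c ⊔ ℓ)
GC G S α isGC = record
  { vertices   = setoid
  ; Adjacent   = λ y h → Member S (⟦ α ⟧ (y ⁻¹) ∙ h)
  ; adj-resp   = (λ h≈h′ → Subset.resp S (∙-congˡ h≈h′))
               , (λ y≈y′ → Subset.resp S (∙-congʳ (Automorphism.⟦⟧-cong α (⁻¹-cong y≈y′))))
  ; adj-sym    = λ {y} {h} → IsGenCayleySubset.symmetric isGC h y
  ; adj-irrefl = IsGenCayleySubset.no-loops isGC
  }
  where open Group G

RestrictedGCI : Group c ℓ → Set (suc (c ⊔ ℓ))
RestrictedGCI G =
  ∀ (S₁ S₂ : Subset G) (α₁ α₂ : Automorphism G)
    (gc₁ : IsGenCayleySubset α₁ S₁) (gc₂ : IsGenCayleySubset α₂ S₂) →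
  Involution (Aut G) α₁ → Involution (Aut G) α₂ →
  GC G S₁ α₁ gc₁ ≅ GC G S₂ α₂ gc₂ →
  ∃ λ y → ∃ λ γ →
    (α₂ A.≈ γ A.∙ α₁ A.∙ γ A.⁻¹) ×
    (Member S₂ ≐ leftMul G (⟦ α₂ ⟧ y) (rightMul G (image G γ (Member S₁)) (y ⁻¹)))
  where
  open Group G using (_⁻¹)
  module A = Group (Aut G)

-- Since G is complete, every involution of Aut G is σ(a) for an involution a of
-- G, and γ σ(a) γ⁻¹ = σ(a^γ). For an involution b, the relation
-- S = y^σ(b) T y⁻¹ is equivalent to bS = (bT)^σ(y), which explains the
-- translates gS₁ and gS₂ in (ii). If G is a restricted GCI-group, comparing the
-- empty graphs GC(G, ∅, σ(g)) and GC(G, ∅, σ(h)) for an involution h shows that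
-- h is conjugate to g. Conversely, by (i) any two graphs as in the definition
-- are transported, by inner automorphisms, to graphs induced by σ(g).
module Submission where

open import Defs
open import Algebra.Bundles using (Group)
import Algebra.Properties.Group as GroupProperties
open import Data.Empty.Polymorphic using (⊥)
open import Data.Product using (∃; _×_; _,_; proj₁; proj₂)
open import Function.Base using (id; _∘_)
open import Function.Bundles using (Equivalence; Inverse; _⇔_; mk⇔)
import Function.Construct.Composition as Composition
import Function.Construct.Identity as Identity
import Function.Construct.Symmetry as Symmetry
open import Level using (Level; _⊔_)
open import Relation.Binary.Bundles using (Setoid)
open import Relation.Binary.Definitions using (_Respects_)
import Relation.Binary.Reasoning.Setoid as SetoidReasoning
open import Relation.Nullary using (no)
open import Relation.Unary using (Pred; _≐_; _⊆_)
open import Relation.Unary.Properties using (≐-sym; ≐-trans)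
open import Relation.Unary.Relation.Binary.Equality using (≐-setoid)

private
  variable
    a b c d e f k p q ℓ ℓ₁ ℓ₂ ℓ₃ : Level

-- Symmetry and transitivity of graph isomorphism.

≅-sym : {X : Graph a ℓ₁ e} {Y : Graph b ℓ₂ f} → X ≅ Y → Y ≅ X
≅-sym {X = X} {Y} X≅Y = record
  { bijection = Symmetry.inverse bijection
  ; preserves = λ x y → mk⇔
      (λ xy → Equivalence.from (preserves (from x) (from y))
        (Y-resp (Y.sym (strictlyInverseˡ x)) (Y.sym (strictlyInverseˡ y)) xy))
      (λ xy → Y-resp (strictlyInverseˡ x) (strictlyInverseˡ y)
        (Equivalence.to (preserves (from x) (from y)) xy))
  }
  where
  module Y where
    open Graph Y public
    open Setoid vertices public using (sym)
  open _≅_ X≅Y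
  open Inverse bijection

  Y-resp : ∀ {x x′ y y′} → x Y.≈ x′ → y Y.≈ y′ → Y.Adjacent x y → Y.Adjacent x′ y′
  Y-resp x≈x′ y≈y′ = proj₁ Y.adj-resp y≈y′ ∘ proj₂ Y.adj-resp x≈x′

≅-trans : {X : Graph a ℓ₁ e} {Y : Graph b ℓ₂ f} {Z : Graph d ℓ₃ k} → X ≅ Y → Y ≅ Z → X ≅ Z
≅-trans X≅Y Y≅Z = record
  { bijection = Composition.inverse (_≅_.bijection X≅Y) (_≅_.bijection Y≅Z)
  ; preserves = λ x y → Composition.equivalence
      (_≅_.preserves X≅Y x y)
      (_≅_.preserves Y≅Z (to x) (to y))
  }
  where open Inverse (_≅_.bijection X≅Y) using (to)

-- Images of predicates under functions.

module _ (S : Setoid c ℓ) where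
  open Setoid S

  -- leftMul, rightMul and image are instances of this by unfolding.
  Image : (Carrier → Carrier) → Pred Carrier p → Pred Carrier (c ⊔ ℓ ⊔ p)
  Image f P y = ∃ λ x → P x × y ≈ f x

  Image-cong : (f : Carrier → Carrier) {P : Pred Carrier p} {Q : Pred Carrier q} →
               P ≐ Q → Image f P ≐ Image f Q
  Image-cong f (P⊆Q , Q⊆P) =
    (λ (x , Px , eq) → x , P⊆Q Px , eq) , (λ (x , Qx , eq) → x , Q⊆P Qx , eq)

  Image-≗ : {f g : Carrier → Carrier} {P : Pred Carrier p} →
            (∀ x → f x ≈ g x) → Image f P ≐ Image g P
  Image-≗ f≗g =
    (λ (x , Px , eq) → x , Px , trans eq (f≗g x)) ,
    (λ (x , Px , eq) → x , Px , trans eq (sym (f≗g x)))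

  Image-∘ : (f g : Carrier → Carrier) {P : Pred Carrier p} → (∀ {x y} → x ≈ y → f x ≈ f y) →
            Image f (Image g P) ≐ Image (f ∘ g) P
  Image-∘ f g f-cong =
    (λ (_ , (x , Px , eq) , eq′) → x , Px , trans eq′ (f-cong eq)) ,
    (λ (x , Px , eq) → g x , (x , Px , refl) , eq)

  Image-id : {f : Carrier → Carrier} {P : Pred Carrier p} → P Respects _≈_ →
             (∀ x → f x ≈ x) → Image f P ≐ P
  Image-id P-resp f≗id =
    (λ (x , Px , eq) → P-resp (sym (trans eq (f≗id x))) Px) ,
    (λ {x} Px → x , Px , sym (f≗id x))

  -- Both iterated images are images under a composite, and the composites agree pointwise.
  -- Identities between subsets thus reduce to identities between elements.
  Image-square : {f g f′ g′ : Carrier → Carrier} {P : Pred Carrier p} →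
                 (∀ {x y} → x ≈ y → f x ≈ f y) → (∀ {x y} → x ≈ y → f′ x ≈ f′ y) →
                 (∀ x → f (g x) ≈ f′ (g′ x)) →
                 Image f (Image g P) ≐ Image f′ (Image g′ P)
  Image-square {f = f} {g} {f′} {g′} f-cong f′-cong fg≗f′g′ =
    ≐-trans (Image-∘ f g f-cong)
      (≐-trans (Image-≗ fg≗f′g′) (≐-sym (Image-∘ f′ g′ f′-cong)))

module _ (G : Group c ℓ) where
  open Group G
  open GroupProperties G
  private
    module _ (φ : Automorphism G) where
      open Automorphism φ public using (⟦⟧-cong; ∙-homo; ε-homo; ⁻¹-homo; injective)

    module A = Group (Aut G)
    module ≈R = SetoidReasoning setoid
    module ≐R = SetoidReasoning (≐-setoid Carrier (c ⊔ ℓ))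

  -- Inner automorphisms and involutions.

  σ-cong : ∀ {x y} → x ≈ y → σ {G = G} x A.≈ σ y
  σ-cong x≈y h = ∙-cong (∙-congʳ x≈y) (⁻¹-cong x≈y)

  σ-ε : σ {G = G} ε A.≈ A.ε
  σ-ε h = trans (∙-cong (identityˡ h) ε⁻¹≈ε) (identityʳ h)

  σ-homo : ∀ x y → σ {G = G} (x ∙ y) A.≈ σ x A.∙ σ y
  σ-homo x y h = begin
    x ∙ y ∙ h ∙ (x ∙ y) ⁻¹      ≈⟨ ∙-cong (assoc x y h) (⁻¹-anti-homo-∙ x y) ⟩
    x ∙ (y ∙ h) ∙ (y ⁻¹ ∙ x ⁻¹) ≈⟨ assoc (x ∙ (y ∙ h)) (y ⁻¹) (x ⁻¹) ⟨
    x ∙ (y ∙ h) ∙ y ⁻¹ ∙ x ⁻¹   ≈⟨ ∙-congʳ (assoc x (y ∙ h) (y ⁻¹)) ⟩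
    x ∙ (y ∙ h ∙ y ⁻¹) ∙ x ⁻¹   ∎
    where open ≈R

  -- Stated without `φ A.⁻¹`, so that it serves directly as a commuting square for transporting
  -- graphs and images.
  ∘σ : ∀ φ x → φ A.∙ σ {G = G} x A.≈ σ (⟦ φ ⟧ x) A.∙ φ
  ∘σ φ x h = begin
    ⟦ φ ⟧ (x ∙ h ∙ x ⁻¹)               ≈⟨ ∙-homo φ (x ∙ h) (x ⁻¹) ⟩
    ⟦ φ ⟧ (x ∙ h) ∙ ⟦ φ ⟧ (x ⁻¹)       ≈⟨ ∙-cong (∙-homo φ x h) (⁻¹-homo φ x) ⟩
    ⟦ φ ⟧ x ∙ ⟦ φ ⟧ h ∙ (⟦ φ ⟧ x) ⁻¹   ∎
    where open ≈R

  conjugate-σ : ∀ φ x → φ A.∙ σ {G = G} x A.∙ φ A.⁻¹ A.≈ σ (⟦ φ ⟧ x)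
  conjugate-σ φ x h = trans (∘σ φ x (⟦ φ A.⁻¹ ⟧ h))
    (⟦⟧-cong (σ (⟦ φ ⟧ x)) (invAut-inverseʳ φ h))

  automorphism-involution : ∀ φ {x} → Involution G x → Involution G (⟦ φ ⟧ x)
  automorphism-involution φ {x} (x≉ε , xx≈ε) =
    (λ φx≈ε → x≉ε (injective φ (trans φx≈ε (sym (ε-homo φ))))) ,
    trans (sym (∙-homo φ x x)) (trans (⟦⟧-cong φ xx≈ε) (ε-homo φ))

  involution-resp : ∀ {x y} → x ≈ y → Involution G x → Involution G y
  involution-resp x≈y (x≉ε , xx≈ε) =
    (λ y≈ε → x≉ε (trans x≈y y≈ε)) , trans (sym (∙-cong x≈y x≈y)) xx≈ε

  -- When conjugation by `x` and by `y` agree, `y ⁻¹ ∙ x` is central, hence trivial.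
  σ-injective : Center G ⊆ (_≈ ε) → ∀ {x y} → σ {G = G} x A.≈ σ y → x ≈ y
  σ-injective centre⊆ε {x} {y} σx≈σy =
    ⁻¹-injective (sym (inverseˡ-unique (y ⁻¹) x (centre⊆ε central)))
    where
    open ≈R
    central : Center G (y ⁻¹ ∙ x)
    central h = begin
      y ⁻¹ ∙ x ∙ h                     ≈⟨ assoc (y ⁻¹) x h ⟩
      y ⁻¹ ∙ (x ∙ h)                   ≈⟨ ∙-congˡ (//-rightDividesˡ x (x ∙ h)) ⟨
      y ⁻¹ ∙ (x ∙ h ∙ x ⁻¹ ∙ x)        ≈⟨ ∙-congˡ (∙-congʳ (σx≈σy h)) ⟩
      y ⁻¹ ∙ (y ∙ h ∙ y ⁻¹ ∙ x)        ≈⟨ ∙-congˡ (assoc (y ∙ h) (y ⁻¹) x) ⟩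
      y ⁻¹ ∙ (y ∙ h ∙ (y ⁻¹ ∙ x))      ≈⟨ ∙-congˡ (assoc y h (y ⁻¹ ∙ x)) ⟩
      y ⁻¹ ∙ (y ∙ (h ∙ (y ⁻¹ ∙ x)))    ≈⟨ \\-leftDividesʳ y _ ⟩
      h ∙ (y ⁻¹ ∙ x)                   ∎

  σ-involution : Center G ⊆ (_≈ ε) → ∀ {x} → Involution G x → Involution (Aut G) (σ x)
  σ-involution centre⊆ε {x} (x≉ε , xx≈ε) =
    (λ σx≈id → x≉ε (σ-injective centre⊆ε (A.trans {σ x} {A.ε} {σ ε} σx≈id (λ h → sym (σ-ε h))))) ,
    (λ h → trans (sym (σ-homo x x h)) (trans (σ-cong xx≈ε h) (σ-ε h)))

  -- Squaring `α` gives `σ (x ∙ x)`, so `x ∙ x` is trivial by injectivity of `σ`. This trades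
  -- automorphisms of order 2 for involutions of `G`.
  involution-of-σ : Center G ⊆ (_≈ ε) → ∀ {α x} → α A.≈ σ x → Involution (Aut G) α → Involution G x
  involution-of-σ centre⊆ε {α} {x} α≈σx (α≉id , αα≈id) =
    (λ x≈ε → α≉id (λ h → trans (α≈σx h) (trans (σ-cong x≈ε h) (σ-ε h)))) ,
    σ-injective centre⊆ε λ h → begin
      ⟦ σ {G = G} (x ∙ x) ⟧ h              ≈⟨ σ-homo x x h ⟩
      ⟦ σ {G = G} x ⟧ (⟦ σ {G = G} x ⟧ h)  ≈⟨ ⟦⟧-cong (σ x) (α≈σx h) ⟨
      ⟦ σ {G = G} x ⟧ (⟦ α ⟧ h)            ≈⟨ α≈σx (⟦ α ⟧ h) ⟨
      ⟦ α ⟧ (⟦ α ⟧ h)                      ≈⟨ αα≈id h ⟩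
      h                                    ≈⟨ σ-ε h ⟨
      ⟦ σ {G = G} ε ⟧ h                    ∎
    where open ≈R

  -- Edgeless graphs, and transport of generalized Cayley graphs along automorphisms.

  ∅ : Subset G
  ∅ = record { Member = λ _ → ⊥ ; resp = λ _ () ; member? = λ _ → no λ () }

  ∅-isGenCayley : ∀ {α} → α A.∙ α A.≈ A.ε → IsGenCayleySubset α ∅
  ∅-isGenCayley αα≈id = record
    { squares-to-id = αα≈id ; no-loops = λ _ () ; symmetric = λ _ _ () }

  -- Neither graph has edges, so the identity works for any `α` and `β`. Applied to these graphs,
  -- the restricted GCI property yields a conjugacy of automorphisms with no graph-theoretic input.
  GC-∅-≅ : ∀ {α β} (gcα : IsGenCayleySubset α ∅) (gcβ : IsGenCayleySubset β ∅) →
           GC G ∅ α gcα ≅ GC G ∅ β gcβ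
  GC-∅-≅ _ _ = record
    { bijection = Identity.inverse setoid ; preserves = λ _ _ → mk⇔ id id }

  -- This is the image of `S` under `φ A.⁻¹`, in the form where membership is decided by evaluating
  -- `φ`.
  preimage : Automorphism G → Subset G → Subset G
  preimage φ S = record
    { Member  = λ x → Member S (⟦ φ ⟧ x)
    ; resp    = λ x≈y → Subset.resp S (⟦⟧-cong φ x≈y)
    ; member? = λ x → Subset.member? S (⟦ φ ⟧ x)
    }

  image-preimage : ∀ φ S → image G (φ A.⁻¹) (Member S) ≐ Member (preimage φ S)
  image-preimage φ S =
    (λ (s , Ss , eq) → Subset.resp S
      (sym (trans (⟦⟧-cong φ eq) (invAut-inverseʳ φ s))) Ss) ,
    (λ {x} Sφx → ⟦ φ ⟧ x , Sφx , sym (invAut-inverseˡ φ x))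

  module _ (φ α β : Automorphism G) (φβ≈αφ : φ A.∙ β A.≈ α A.∙ φ)
           (S : Subset G) (gc : IsGenCayleySubset α S) where
    open IsGenCayleySubset gc

    private
      -- The intertwining relation moves `φ` past `β`. The loop condition, the symmetry condition
      -- and the preservation of adjacency are all transports along this identity.
      edge : ∀ y h → ⟦ φ ⟧ (⟦ β ⟧ (y ⁻¹) ∙ h) ≈ ⟦ α ⟧ ((⟦ φ ⟧ y) ⁻¹) ∙ ⟦ φ ⟧ h
      edge y h = begin
        ⟦ φ ⟧ (⟦ β ⟧ (y ⁻¹) ∙ h)           ≈⟨ ∙-homo φ (⟦ β ⟧ (y ⁻¹)) h ⟩
        ⟦ φ ⟧ (⟦ β ⟧ (y ⁻¹)) ∙ ⟦ φ ⟧ h     ≈⟨ ∙-congʳ (φβ≈αφ (y ⁻¹)) ⟩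
        ⟦ α ⟧ (⟦ φ ⟧ (y ⁻¹)) ∙ ⟦ φ ⟧ h     ≈⟨ ∙-congʳ (⟦⟧-cong α (⁻¹-homo φ y)) ⟩
        ⟦ α ⟧ ((⟦ φ ⟧ y) ⁻¹) ∙ ⟦ φ ⟧ h     ∎
        where open ≈R

    preimage-isGenCayley : IsGenCayleySubset β (preimage φ S)
    preimage-isGenCayley = record
      -- Two uses of the intertwining relation turn `φ` of `β` squared into `α` squared of `φ`.
      { squares-to-id = λ y → injective φ (trans (φβ≈αφ (⟦ β ⟧ y))
          (trans (⟦⟧-cong α (φβ≈αφ y)) (squares-to-id (⟦ φ ⟧ y))))
      ; no-loops  = λ y → no-loops (⟦ φ ⟧ y) ∘ Subset.resp S (edge y y)
      ; symmetric = λ y h → Subset.resp S (sym (edge y h)) ∘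
          symmetric (⟦ φ ⟧ y) (⟦ φ ⟧ h) ∘ Subset.resp S (edge h y)
      }

    GC-preimage-≅ : GC G (preimage φ S) β preimage-isGenCayley ≅ GC G S α gc
    GC-preimage-≅ = record
      { bijection = record
        { to        = ⟦ φ ⟧
        ; from      = ⟦ φ A.⁻¹ ⟧
        ; to-cong   = ⟦⟧-cong φ
        ; from-cong = ⟦⟧-cong (φ A.⁻¹)
        ; inverse   =
            (λ {x} eq → trans (⟦⟧-cong φ eq) (invAut-inverseʳ φ x)) ,
            (λ {x} eq → trans (⟦⟧-cong (φ A.⁻¹) eq) (invAut-inverseˡ φ x))
        }
      ; preserves = λ y h →
          mk⇔ (Subset.resp S (edge y h)) (Subset.resp S (sym (edge y h)))
      }

  -- Translates of subsets, and the twisted translate by an involution.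

  image-cong : ∀ φ {P Q : Pred Carrier (c ⊔ ℓ)} → P ≐ Q → image G φ P ≐ image G φ Q
  image-cong φ = Image-cong setoid ⟦ φ ⟧

  image-∘ : ∀ φ ψ {P : Pred Carrier (c ⊔ ℓ)} →
            image G φ (image G ψ P) ≐ image G (φ A.∙ ψ) P
  image-∘ φ ψ = Image-∘ setoid ⟦ φ ⟧ ⟦ ψ ⟧ (⟦⟧-cong φ)

  image-leftMul : ∀ φ x (P : Pred Carrier (c ⊔ ℓ)) →
                  image G φ (leftMul G x P) ≐ leftMul G (⟦ φ ⟧ x) (image G φ P)
  image-leftMul φ x _ = Image-square setoid (⟦⟧-cong φ) ∙-congˡ (∙-homo φ x)

  leftMul-≈ : ∀ {x y} (P : Pred Carrier (c ⊔ ℓ)) → x ≈ y → leftMul G x P ≐ leftMul G y P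
  leftMul-≈ _ x≈y = Image-≗ setoid λ _ → ∙-congʳ x≈y

  module _ {b} (bb≈ε : b ∙ b ≈ ε) where

    cancel-involution : ∀ x → b ∙ (b ∙ x) ≈ x
    cancel-involution x = trans (sym (assoc b b x)) (trans (∙-congʳ bb≈ε) (identityˡ x))

    leftMul-involutive : {P : Pred Carrier (c ⊔ ℓ)} → P Respects _≈_ →
                         leftMul G b (leftMul G b P) ≐ P
    leftMul-involutive {P} P-resp =
      ≐-trans (Image-∘ setoid (b ∙_) (b ∙_) {P = P} ∙-congˡ)
        (Image-id setoid P-resp cancel-involution)

    -- Since `b` is its own inverse, the trailing `b ⁻¹` of the conjugate becomes the `b` that
    -- multiplies `u`; the rest is reassociation.
    twist : ∀ y u → ⟦ σ {G = G} b ⟧ y ∙ (u ∙ y ⁻¹) ≈ b ∙ ⟦ σ {G = G} y ⟧ (b ∙ u)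
    twist y u = begin
      b ∙ y ∙ b ⁻¹ ∙ (u ∙ y ⁻¹)    ≈⟨ ∙-congʳ (∙-congˡ (inverseˡ-unique b b bb≈ε)) ⟨
      b ∙ y ∙ b ∙ (u ∙ y ⁻¹)       ≈⟨ ∙-congʳ (assoc b y b) ⟩
      b ∙ (y ∙ b) ∙ (u ∙ y ⁻¹)     ≈⟨ assoc b (y ∙ b) (u ∙ y ⁻¹) ⟩
      b ∙ (y ∙ b ∙ (u ∙ y ⁻¹))     ≈⟨ ∙-congˡ (assoc (y ∙ b) u (y ⁻¹)) ⟨
      b ∙ (y ∙ b ∙ u ∙ y ⁻¹)       ≈⟨ ∙-congˡ (∙-congʳ (assoc y b u)) ⟩
      b ∙ (y ∙ (b ∙ u) ∙ y ⁻¹)     ∎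
      where open ≈R

    twisted-translate : ∀ {α} → α A.≈ σ b → ∀ y (P : Pred Carrier (c ⊔ ℓ)) →
      leftMul G (⟦ α ⟧ y) (rightMul G P (y ⁻¹)) ≐
      leftMul G b (image G (σ y) (leftMul G b P))
    twisted-translate {α} α≈σb y P =
      ≐-trans
        -- The right side is first grouped as `b ∙_` after a single inner map; that map is then
        -- split into its two factors.
        (Image-square setoid {f′ = b ∙_} {g′ = λ u → ⟦ σ {G = G} y ⟧ (b ∙ u)} ∙-congˡ ∙-congˡ
          (λ u → trans (∙-congʳ (α≈σb y)) (twist y u)))
        (Image-cong setoid (b ∙_)
          (≐-sym (Image-∘ setoid ⟦ σ {G = G} y ⟧ (b ∙_) (⟦⟧-cong (σ y)))))

    -- Left multiplication by `b` undoes itself, so applying it to either relation gives the other.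
    -- Allowing `α` to be merely pointwise equal to `σ b` covers automorphisms known to be inner
    -- only through `all-inner`.
    twisted-translate⇔ : ∀ {α} → α A.≈ σ b → (S : Subset G) → ∀ y (P : Pred Carrier (c ⊔ ℓ)) →
      (Member S ≐ leftMul G (⟦ α ⟧ y) (rightMul G P (y ⁻¹))) ⇔
      (leftMul G b (Member S) ≐ image G (σ y) (leftMul G b P))
    twisted-translate⇔ {α} α≈σb S y P = mk⇔
      (λ S≐ → ≐-trans (Image-cong setoid (b ∙_) (≐-trans S≐ twisted))
        (leftMul-involutive image-resp))
      (λ bS≐ → ≐-trans (≐-sym (leftMul-involutive (Subset.resp S)))
        (≐-trans (Image-cong setoid (b ∙_) bS≐) (≐-sym twisted)))
      where
      twisted = twisted-translate {α} α≈σb y P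

      image-resp : image G (σ y) (leftMul G b P) Respects _≈_
      image-resp x≈x′ (s , s∈ , eq) = s , s∈ , trans (sym x≈x′) eq

  -- The two implications of the equivalence.

  ConjugacyCondition : Carrier → Set (c ⊔ ℓ)
  ConjugacyCondition g = Involution G ≐ ConjugacyClass G g

  IsomorphismCondition : Carrier → Set _
  IsomorphismCondition g =
    ∀ (S₁ S₂ : Subset G)
      (gc₁ : IsGenCayleySubset (σ g) S₁) (gc₂ : IsGenCayleySubset (σ g) S₂) →
    GC G S₁ (σ g) gc₁ ≅ GC G S₂ (σ g) gc₂ →
    ∃ λ x → leftMul G g (Member S₂) ≐ image G (σ x) (leftMul G g (Member S₁))

  module _ (complete : IsComplete G) {g : Carrier} (g-inv : Involution G g) where
    open IsComplete complete
    private
      centre⊆ε : Center G ⊆ (_≈ ε)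
      centre⊆ε = proj₁ center-trivial

    module _ (gci : RestrictedGCI G) where

      restrictedGCI⇒conjugacy : ConjugacyCondition g
      restrictedGCI⇒conjugacy = conjugate , λ (x , h≈xgx⁻¹) →
        involution-resp (sym h≈xgx⁻¹) (automorphism-involution (σ x) g-inv)
        where
        conjugate : Involution G ⊆ ConjugacyClass G g
        conjugate {h} h-inv =
          let σg-inv = σ-involution centre⊆ε g-inv
              σh-inv = σ-involution centre⊆ε h-inv
              gcg = ∅-isGenCayley {σ g} (proj₂ σg-inv)
              gch = ∅-isGenCayley {σ h} (proj₂ σh-inv)
              y , γ , σh≈γσgγ⁻¹ , _ =
                gci ∅ ∅ (σ g) (σ h) gcg gch σg-inv σh-inv (GC-∅-≅ {σ g} {σ h} gcg gch)
              x , γ≈σx = all-inner γ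
          -- Here `σ h` equals `σ (⟦ γ ⟧ g)`, so `h` is the image of `g` under `γ`, which is
          -- conjugation by `x`.
          in x , trans (σ-injective centre⊆ε
                   (λ z → trans (σh≈γσgγ⁻¹ z) (conjugate-σ γ g z))) (γ≈σx g)

      restrictedGCI⇒isomorphism : IsomorphismCondition g
      restrictedGCI⇒isomorphism S₁ S₂ gc₁ gc₂ X₁≅X₂
        with y , γ , σg≈γσgγ⁻¹ , S₂≐ ← gci S₁ S₂ (σ g) (σ g) gc₁ gc₂
               (σ-involution centre⊆ε g-inv) (σ-involution centre⊆ε g-inv) X₁≅X₂
        -- The factor `x` realises `γ`, and `y` comes from the twisted translate; `σ` of the product
        -- applies `σ x` first.
        with x , γ≈σx ← all-inner γ = y ∙ x , (begin
          leftMul G g (Member S₂)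
            ≈⟨ Equivalence.to (twisted-translate⇔ (proj₂ g-inv) {σ g} (λ _ → refl) S₂ y _) S₂≐ ⟩
          image G (σ y) (leftMul G g (image G γ (Member S₁)))
            ≈⟨ image-cong (σ y) (leftMul-≈ _ g≈γg) ⟩
          image G (σ y) (leftMul G (⟦ γ ⟧ g) (image G γ (Member S₁)))
            ≈⟨ image-cong (σ y) (image-leftMul γ g _) ⟨
          image G (σ y) (image G γ (leftMul G g (Member S₁)))
            ≈⟨ image-cong (σ y) (Image-≗ setoid γ≈σx) ⟩
          image G (σ y) (image G (σ x) (leftMul G g (Member S₁)))
            ≈⟨ image-∘ (σ y) (σ x) ⟩
          image G (σ y A.∙ σ x) (leftMul G g (Member S₁))
            ≈⟨ Image-≗ setoid (σ-homo y x) ⟨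
          image G (σ (y ∙ x)) (leftMul G g (Member S₁)) ∎)
        where
        open ≐R
        -- Conjugation by `γ` fixes `σ g`, and `σ` is injective. Hence `γ` passes through left
        -- multiplication by `g`.
        g≈γg : g ≈ ⟦ γ ⟧ g
        g≈γg = σ-injective centre⊆ε (λ z → trans (σg≈γσgγ⁻¹ z) (conjugate-σ γ g z))

    conditions⇒restrictedGCI : ConjugacyCondition g → IsomorphismCondition g → RestrictedGCI G
    conditions⇒restrictedGCI involutions≐class iso-condition S₁ S₂ α₁ α₂ gc₁ gc₂ α₁-inv α₂-inv X₁≅X₂
      with a₁ , α₁≈σa₁ ← all-inner α₁
      with a₂ , α₂≈σa₂ ← all-inner α₂
      -- Condition (i) writes `a₁`, and likewise `a₂`, as a conjugate of `g`.
      with p₁ , a₁≈ ← proj₁ involutions≐class (involution-of-σ centre⊆ε {α₁} α₁≈σa₁ α₁-inv)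
      with p₂ , a₂≈ ← proj₁ involutions≐class (involution-of-σ centre⊆ε {α₂} α₂≈σa₂ α₂-inv)
      = y , γ , α₂≈γα₁γ⁻¹ ,
        Equivalence.from (twisted-translate⇔ (proj₂ a₂-inv) {α₂} α₂≈σa₂ S₂ y _) a₂S₂≐
      where
      φ₁ φ₂ γ : Automorphism G
      φ₁ = σ p₁
      φ₂ = σ p₂
      -- The route from `a₁` to `a₂` passes through `g`: `φ₁ A.⁻¹` sends `a₁` to `g`, and `φ₂` sends
      -- `g` to `a₂`.
      γ  = φ₂ A.∙ φ₁ A.⁻¹

      a₂-inv : Involution G a₂
      a₂-inv = involution-of-σ centre⊆ε {α₂} α₂≈σa₂ α₂-inv

      φ₁σg≈α₁φ₁ : φ₁ A.∙ σ g A.≈ α₁ A.∙ φ₁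
      φ₁σg≈α₁φ₁ z = trans (∘σ φ₁ g z)
        (trans (σ-cong (sym a₁≈) (⟦ φ₁ ⟧ z)) (sym (α₁≈σa₁ (⟦ φ₁ ⟧ z))))

      φ₂σg≈α₂φ₂ : φ₂ A.∙ σ g A.≈ α₂ A.∙ φ₂
      φ₂σg≈α₂φ₂ z = trans (∘σ φ₂ g z)
        (trans (σ-cong (sym a₂≈) (⟦ φ₂ ⟧ z)) (sym (α₂≈σa₂ (⟦ φ₂ ⟧ z))))

      γa₁≈a₂ : ⟦ γ ⟧ a₁ ≈ a₂
      γa₁≈a₂ = trans (⟦⟧-cong φ₂ (trans (⟦⟧-cong (φ₁ A.⁻¹) a₁≈) (invAut-inverseˡ φ₁ g))) (sym a₂≈)

      α₂≈γα₁γ⁻¹ : α₂ A.≈ γ A.∙ α₁ A.∙ γ A.⁻¹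
      α₂≈γα₁γ⁻¹ z = begin
        ⟦ α₂ ⟧ z                                  ≈⟨ α₂≈σa₂ z ⟩
        ⟦ σ {G = G} a₂ ⟧ z                        ≈⟨ σ-cong γa₁≈a₂ z ⟨
        ⟦ σ {G = G} (⟦ γ ⟧ a₁) ⟧ z                ≈⟨ conjugate-σ γ a₁ z ⟨
        ⟦ γ A.∙ σ a₁ A.∙ γ A.⁻¹ ⟧ z               ≈⟨ ⟦⟧-cong γ (α₁≈σa₁ (⟦ γ A.⁻¹ ⟧ z)) ⟨
        ⟦ γ A.∙ α₁ A.∙ γ A.⁻¹ ⟧ z                 ∎
        where open ≈R

      T₁ T₂ : Subset G
      T₁ = preimage φ₁ S₁
      T₂ = preimage φ₂ S₂

      translates-conjugate : ∃ λ x → leftMul G g (Member T₂) ≐ image G (σ x) (leftMul G g (Member T₁))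
      translates-conjugate = iso-condition T₁ T₂
        (preimage-isGenCayley φ₁ α₁ (σ g) φ₁σg≈α₁φ₁ S₁ gc₁)
        (preimage-isGenCayley φ₂ α₂ (σ g) φ₂σg≈α₂φ₂ S₂ gc₂)
        -- The isomorphism runs from the graph of `T₁` to that of `S₁`, then to that of `S₂`, and
        -- back to that of `T₂`; both ends are induced by `σ g`.
        (≅-trans (GC-preimage-≅ φ₁ α₁ (σ g) φ₁σg≈α₁φ₁ S₁ gc₁)
          (≅-trans X₁≅X₂ (≅-sym (GC-preimage-≅ φ₂ α₂ (σ g) φ₂σg≈α₂φ₂ S₂ gc₂))))

      x y : Carrier
      x = proj₁ translates-conjugate
      -- Pushing forward along `φ₂` turns conjugation by `x` into conjugation by its image, by `∘σ`.
      y = ⟦ φ₂ ⟧ x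

      φ₂T₂≐S₂ : image G φ₂ (Member T₂) ≐ Member S₂
      φ₂T₂≐S₂ = begin
        image G φ₂ (Member T₂)
          ≈⟨ image-cong φ₂ (image-preimage φ₂ S₂) ⟨
        image G φ₂ (image G (φ₂ A.⁻¹) (Member S₂))
          ≈⟨ image-∘ φ₂ (φ₂ A.⁻¹) ⟩
        image G (φ₂ A.∙ φ₂ A.⁻¹) (Member S₂)
          ≈⟨ Image-id setoid (Subset.resp S₂) (invAut-inverseʳ φ₂) ⟩
        Member S₂ ∎
        where open ≐R

      -- `T₁` is the image of `S₁` under `φ₁ A.⁻¹`, and following it by `φ₂` gives `γ` by
      -- definition.
      φ₂T₁≐γS₁ : image G φ₂ (Member T₁) ≐ image G γ (Member S₁)
      φ₂T₁≐γS₁ = ≐-trans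
        (image-cong φ₂ (≐-sym (image-preimage φ₁ S₁)))
        (image-∘ φ₂ (φ₁ A.⁻¹))

      -- Since `φ₂` sends `g` to `a₂`, it carries the conclusion of condition (ii), about translates
      -- by `g`, to translates by `a₂`.
      φ₂-translate : {P Q : Pred Carrier (c ⊔ ℓ)} → image G φ₂ P ≐ Q →
                     image G φ₂ (leftMul G g P) ≐ leftMul G a₂ Q
      φ₂-translate {P} {Q} φ₂P≐Q = begin
        image G φ₂ (leftMul G g P)            ≈⟨ image-leftMul φ₂ g P ⟩
        leftMul G (⟦ φ₂ ⟧ g) (image G φ₂ P)   ≈⟨ leftMul-≈ _ a₂≈ ⟨
        leftMul G a₂ (image G φ₂ P)           ≈⟨ Image-cong setoid (a₂ ∙_) φ₂P≐Q ⟩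
        leftMul G a₂ Q                        ∎
        where open ≐R

      a₂S₂≐ : leftMul G a₂ (Member S₂) ≐ image G (σ y) (leftMul G a₂ (image G γ (Member S₁)))
      a₂S₂≐ = begin
        leftMul G a₂ (Member S₂)
          ≈⟨ φ₂-translate φ₂T₂≐S₂ ⟨
        image G φ₂ (leftMul G g (Member T₂))
          ≈⟨ image-cong φ₂ (proj₂ translates-conjugate) ⟩
        image G φ₂ (image G (σ x) (leftMul G g (Member T₁)))
          ≈⟨ Image-square setoid (⟦⟧-cong φ₂) (⟦⟧-cong (σ y)) (∘σ φ₂ x) ⟩
        image G (σ y) (image G φ₂ (leftMul G g (Member T₁)))
          ≈⟨ image-cong (σ y) (φ₂-translate φ₂T₁≐γS₁) ⟩
        image G (σ y) (leftMul G a₂ (image G γ (Member S₁))) ∎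
        where open ≐R

theorem4p8 : ∀ {c ℓ} (G : Group c ℓ) → IsFinite G → IsComplete G →
    (g : Group.Carrier G) → Involution G g →
    RestrictedGCI G ⇔
      ((Involution G ≐ ConjugacyClass G g) ×
       (∀ (S₁ S₂ : Subset G)
          (gc₁ : IsGenCayleySubset (σ g) S₁) (gc₂ : IsGenCayleySubset (σ g) S₂) →
          GC G S₁ (σ g) gc₁ ≅ GC G S₂ (σ g) gc₂ →
          ∃ λ x → leftMul G g (Member S₂) ≐ image G (σ x) (leftMul G g (Member S₁))))
theorem4p8 G _ complete g g-inv = mk⇔
  (λ gci → restrictedGCI⇒conjugacy G complete g-inv gci ,
           restrictedGCI⇒isomorphism G complete g-inv gci)
  (λ (conjugacy , isomorphism) → conditions⇒restrictedGCI G complete g-inv conjugacy isomorphism)
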